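{- There is an absolute constant $C>0$ such that the following holds. Let $\ell$ be a prime number, $d\ge 1$ an integer, and $n\ge Cd\log d$. If $\mathcal A$ is a $d$-defect $\ell$-oddtown in $[n]$, then $|\mathcal A|\le (d+1)\left(n-2\left(\lceil\log_2(d+2)\rceil-1\right)\right)$.
   Context: A family $\mathcal A=\{A_1,\ldots,A_m\}$ of distinct subsets of $[n]$ is a $d$-defect $\ell$-oddtown if for every $i\in[m]$ we have $|A_i|\not\equiv 0 \pmod \ell$ and there are at most $d$ indices $j\in[m]\setminus\{i\}$ with $|A_i\cap A_j|\not\equiv 0\pmod\ell$.
   Formalization: The condition n ≥ C d log d is read as n ≥ C d (⌊log₂ d⌋ + 1); it is equivalent up to C for d ≥ 2, but for d = 1 it requires n ≥ C, as the literal claim fails there (ℓ = 2, n = 3, the three singletons exceed the bound 2). -}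

module Defs where

open import Data.Nat using (ℕ; _%_)
open import Data.Nat.Base using (NonZero)
open import Data.Fin using (Fin)
open import Data.Fin.Subset using (Subset; ∣_∣; _∩_)
open import Data.List using (List; filter; length)
open import Data.List using () renaming (allFin to allFinL)
open import Data.Nat.Properties using (_≟_)
open import Relation.Nullary using (¬_; Dec; yes; no)
open import Relation.Nullary.Decidable using (¬?)
open import Data.Nat using (_≤_)
open import Relation.Binary.PropositionalEquality using (_≡_)
open import Data.Product using (_×_)
open import Data.Fin using () renaming (_≟_ to _≟F_)

NotDiv : (ℓ : ℕ) .{{_ : NonZero ℓ}} → ℕ → Set
NotDiv ℓ x = ¬ (x % ℓ ≡ 0)

badPartners : ∀ {n m} (ℓ : ℕ) .{{_ : NonZero ℓ}} →
              (Fin m → Subset n) → Fin m → List (Fin m)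
badPartners {n} {m} ℓ A i =
  filter (λ j → ¬? (i ≟F j))
    (filter (λ j → ¬? (∣ A i ∩ A j ∣ % ℓ ≟ 0)) (allFinL m))

-- A family A_1..A_m of distinct subsets of [n] (distinctness imposed separately)
-- is a d-defect ℓ-oddtown.
IsDefectOddtown : ∀ {n m} (d ℓ : ℕ) .{{_ : NonZero ℓ}} → (Fin m → Subset n) → Set
IsDefectOddtown {n} {m} d ℓ A =
  (i : Fin m) → NotDiv ℓ ∣ A i ∣ × length (badPartners ℓ A i) ≤ d

{-# OPTIONS --safe #-}
module Submission where

-- Join i and j when ℓ does not divide |Aᵢ ∩ Aⱼ|. Closed neighbourhoods have at most d + 1 elements,
-- and independent sets of vertices are oddtowns, hence have at most n elements. Call a vertex
-- isolated if its closed neighbourhood is a whole component, with d + 1 elements.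
-- If v and w are non-adjacent isolated vertices, a greedy independent set T in the rest has
-- m ≤ (d + 1)(|T| + 2). The neighbourhood of v, together with ∅, consists of d + 2 distinct sets,
-- so 0/1 vectors spanning a space of dimension at least s + 1, s = ⌈log₂(d + 2)⌉ - 1; likewise
-- for w. The two spaces are orthogonal to each other and to T, so |T| + 2(s + 1) ≤ n.
-- If there are no such v and w, discarding at most d + 1 vertices leaves no isolated ones, and then
-- the greedy algorithm finds an independent set of proportion 2/(2d + 1) > 1/(d + 1); for
-- n ≥ 12 d (1 + log₂ d) this gain pays for the loss of 2s.

open import Defs
open import Data.Nat using (ℕ; _*_; _+_; _∸_; _≤_; _≥_; suc)
open import Data.Nat.Primality using (Prime; prime⇒nonZero)
open import Data.Nat.Logarithm using (⌈log₂_⌉; ⌊log₂_⌋)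
open import Data.Fin using (Fin)
open import Data.Fin.Subset using (Subset)
open import Data.Product using (Σ; _×_)
open import Function.Definitions using (Injective)
open import Relation.Binary.PropositionalEquality using (_≡_)

open import Algebra.Properties.Semiring.Sum using (sum; sum-remove; sum-cong-≗)
open import Data.Bool using (if_then_else_)
open import Data.Fin using (zero; suc; _≟_)
open import Data.Fin.Properties using (all?; any?)
open import Data.Fin.Subset using (_∈_; _∉_; _∩_; ∣_∣; ⊥; ⁅_⁆; inside; outside)
open import Data.Fin.Subset.Properties using (_∈?_; ⊆-antisym; ∩-comm; ∩-idem; ∩-zeroˡ; ∣⊥∣≡0)
open import Data.Integer as ℤ using (ℤ; +_)
open import Data.Integer.Divisibility.Signed as ℤ∣ using (divides)
import Data.Integer.Properties as ℤ
import Data.Integer.Tactic.RingSolver as ℤ-Solver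
open import Data.List using (List; []; _∷_; _++_; length; map; filter; reverse; allFin)
open import Data.List.Membership.Propositional using (find) renaming (_∈_ to _∈ᴸ_)
open import Data.List.Membership.Propositional.Properties using (∈-filter⁺; ∈-filter⁻; ∈-allFin; ∈-map⁻)
open import Data.List.Properties using (length-++; length-map; length-reverse; unfold-reverse; filter-all; filter-notAll; length-tabulate)
open import Data.List.Relation.Binary.Pointwise using (Pointwise-≡⇒≡)
open import Data.List.Relation.Binary.Sublist.Heterogeneous.Properties using (toPointwise)
open import Data.List.Relation.Binary.Sublist.Propositional using (⊆-trans; ⊆-refl) renaming (_⊆_ to _⊑_)
open import Data.List.Relation.Binary.Sublist.Propositional.Properties as Sublist using (filter-⊆; length-mono-≤)
open import Data.List.Relation.Unary.All as All using (All; []; _∷_)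
import Data.List.Relation.Unary.All.Properties as All
open import Data.List.Relation.Unary.AllPairs as AllPairs using (AllPairs; []; _∷_)
import Data.List.Relation.Unary.AllPairs.Properties as AllPairs
open import Data.List.Relation.Unary.Any as Any using (here; there)
import Data.List.Relation.Unary.Any.Properties as Any
open import Data.List.Relation.Unary.Unique.Propositional using (Unique)
import Data.List.Relation.Unary.Unique.Propositional.Properties as Unique
open import Data.Nat using (zero; _^_; _<_; z≤n; s≤s; _≤?_; _<?_; _%_; NonZero)
open import Data.Nat.Divisibility using (_∣_; _∣0; ∣1⇒≡1; m%n≡0⇒n∣m; n∣m⇒m%n≡0)
open import Data.Nat.Induction using (Acc; acc; <-wellFounded)
open import Data.Nat.Logarithm using (⌈log₂⌉-mono-≤; ⌈log₂2^n⌉≡n; ⌊log₂⌋-mono-≤; ⌊log₂[2^n]⌋≡n)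
open import Data.Nat.Primality using (euclidsLemma; ¬prime[1])
open import Data.Nat.Properties renaming (_≟_ to _≟ℕ_)
import Data.Nat.Tactic.RingSolver as ℕ-Solver
open import Data.Product using (_,_; proj₁; proj₂; ∃-syntax)
open import Data.Sum using (_⊎_; inj₁; inj₂)
open import Data.Vec using ([]; _∷_; lookup)
open import Data.Vec.Functional using (removeAt)
open import Data.Vec.Properties using ([]=⇒lookup; lookup⇒[]=)
open import Function using (_∘_; flip; id)
open import Level using (Level)
open import Relation.Binary using (Rel)
open import Relation.Binary.PropositionalEquality using (_≢_; refl; sym; trans; cong; cong₂; subst; subst₂; module ≡-Reasoning)
open import Relation.Nullary using (¬_; Dec; yes; no; contradiction)
open import Relation.Nullary.Decidable using (¬?; _×-dec_; _→-dec_; decidable-stable)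
open import Relation.Unary using (Pred; Decidable)

private
  variable
    a p r : Level
    X : Set a
    n : ℕ

-- Lists

length-filter-complement : {P : Pred X p} (P? : Decidable P) (xs : List X) →
  length (filter P? xs) + length (filter (¬? ∘ P?) xs) ≡ length xs
length-filter-complement P? []       = refl
length-filter-complement P? (x ∷ xs) with P? x
... | yes _ = cong suc (length-filter-complement P? xs)
... | no  _ = trans (+-suc _ _) (cong suc (length-filter-complement P? xs))

AllPairs-reverse⁺ : {R : Rel X r} {xs : List X} → AllPairs R xs → AllPairs (flip R) (reverse xs)
AllPairs-reverse⁺ []                          = []
AllPairs-reverse⁺ {xs = x ∷ xs} (Rx ∷ Rxs) rewrite unfold-reverse x xs =
  AllPairs.++⁺ (AllPairs-reverse⁺ Rxs) ([] ∷ []) (All.tabulate λ y∈ → All.lookup Rx (Any.reverse⁻ y∈) ∷ [])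

All⇒AllPairs : {P : Pred X p} {xs : List X} → All P xs → AllPairs (λ _ y → P y) xs
All⇒AllPairs []         = []
All⇒AllPairs (_ ∷ Pxs) = Pxs ∷ All⇒AllPairs Pxs

-- Integer vectors

∑ : (Fin n → ℤ) → ℤ
∑ = sum ℤ.+-*-semiring

infix 8 _·_
_·_ : (Fin n → ℤ) → (Fin n → ℤ) → ℤ
u · v = ∑ (λ i → u i ℤ.* v i)

infixl 6 _⊖_
_⊖_ : (Fin n → ℤ) → (Fin n → ℤ) → Fin n → ℤ
(u ⊖ v) i = u i ℤ.- v i

infixl 7 _⊛_
_⊛_ : ℤ → (Fin n → ℤ) → Fin n → ℤ
(x ⊛ u) i = x ℤ.* u i

·-comm : (u v : Fin n → ℤ) → u · v ≡ v · u
·-comm u v = sum-cong-≗ ℤ.+-*-semiring (λ i → ℤ.*-comm (u i) (v i))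

⊖-· : (u w v : Fin n → ℤ) → (u ⊖ w) · v ≡ u · v ℤ.- w · v
⊖-· {zero}  u w v = refl
⊖-· {suc n} u w v =
  trans (cong (λ z → (u zero ℤ.- w zero) ℤ.* v zero ℤ.+ z) (⊖-· (u ∘ suc) (w ∘ suc) (v ∘ suc)))
        (regroup (u zero) (w zero) (v zero) ((u ∘ suc) · (v ∘ suc)) ((w ∘ suc) · (v ∘ suc)))
  where
  regroup : ∀ x y z s t → (x ℤ.- y) ℤ.* z ℤ.+ (s ℤ.- t) ≡ (x ℤ.* z ℤ.+ s) ℤ.- (y ℤ.* z ℤ.+ t)
  regroup = ℤ-Solver.solve-∀

⊛-· : (x : ℤ) (u v : Fin n → ℤ) → (x ⊛ u) · v ≡ x ℤ.* (u · v)
⊛-· {zero}  x u v = sym (ℤ.*-zeroʳ x)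
⊛-· {suc n} x u v =
  trans (cong (λ z → x ℤ.* u zero ℤ.* v zero ℤ.+ z) (⊛-· x (u ∘ suc) (v ∘ suc)))
        (regroup x (u zero) (v zero) ((u ∘ suc) · (v ∘ suc)))
  where
  regroup : ∀ x y z s → x ℤ.* y ℤ.* z ℤ.+ x ℤ.* s ≡ x ℤ.* (y ℤ.* z ℤ.+ s)
  regroup = ℤ-Solver.solve-∀

∣-∑ : ∀ {k} {f : Fin n → ℤ} → (∀ i → k ℤ∣.∣ f i) → k ℤ∣.∣ ∑ f
∣-∑ {zero}  k∣f = divides (+ 0) refl
∣-∑ {suc n} k∣f = ℤ∣.∣m∣n⇒∣m+n (k∣f zero) (∣-∑ (k∣f ∘ suc))

-- Supplies the pivot coordinate for the elimination.
∤·⇒∤coordinate : ∀ {k} (u v : Fin n → ℤ) → ¬ k ℤ∣.∣ u · v → ∃[ c ] ¬ k ℤ∣.∣ u c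
∤·⇒∤coordinate {k = k} u v k∤u·v with any? (λ c → ¬? (k ℤ∣.∣? u c))
... | yes found = found
... | no  none  = contradiction
  (∣-∑ λ c → ℤ∣.∣m⇒∣m*n (v c) (decidable-stable (k ℤ∣.∣? u c) (λ k∤uc → none (c , k∤uc)))) k∤u·v

·-removeAt : (u v : Fin (suc n) → ℤ) (c : Fin (suc n)) → u c ≡ + 0 →
  removeAt u c · removeAt v c ≡ u · v
·-removeAt u v c uc≡0 = sym (begin
  u · v                                       ≡⟨ sum-remove ℤ.+-*-semiring {i = c} (λ i → u i ℤ.* v i) ⟩
  u c ℤ.* v c ℤ.+ removeAt u c · removeAt v c ≡⟨ cong (λ z → z ℤ.* v c ℤ.+ removeAt u c · removeAt v c) uc≡0 ⟩
  + 0 ℤ.+ removeAt u c · removeAt v c         ≡⟨ ℤ.+-identityˡ _ ⟩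
  removeAt u c · removeAt v c                 ∎)
  where open ≡-Reasoning

-- Rank modulo a prime

module Modulo (ℓ : ℕ) (prime : Prime ℓ) where

  private
    instance
      ℓ≢0 : NonZero ℓ
      ℓ≢0 = prime⇒nonZero prime

  infix 4 ℓ∣_
  ℓ∣_ : ℤ → Set
  ℓ∣ z = + ℓ ℤ∣.∣ z

  ℤ-euclid : ∀ x y → ℓ∣ x ℤ.* y → ¬ ℓ∣ x → ℓ∣ y
  ℤ-euclid x y ℓ∣xy ℓ∤x
    with euclidsLemma ℤ.∣ x ∣ ℤ.∣ y ∣ prime (subst (ℓ ∣_) (ℤ.abs-* x y) (ℤ∣.∣⇒∣ᵤ ℓ∣xy))
  ... | inj₁ ℓ∣x = contradiction (ℤ∣.∣ᵤ⇒∣ ℓ∣x) ℓ∤x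
  ... | inj₂ ℓ∣y = ℤ∣.∣ᵤ⇒∣ ℓ∣y

  -- A list of pairs encodes a matrix: rows come from first components, columns from second
  -- components, entries are their products. Under `AllPairs RightOf` it is lower triangular modulo
  -- `ℓ`.
  VectorPair : ℕ → Set
  VectorPair n = (Fin n → ℤ) × (Fin n → ℤ)

  RightOf : Rel (VectorPair n) _
  RightOf (u , _) (_ , v) = ℓ∣ u · v

  Diagonal : VectorPair n → Set
  Diagonal (u , v) = ¬ ℓ∣ u · v

  -- Gaussian elimination without division: subtracting a multiple of the first row u from a
  -- row w clears coordinate c and, as u annihilates the later columns, only rescales w's entries.
  eliminate : (Fin (suc n) → ℤ) → Fin (suc n) → VectorPair (suc n) → VectorPair n
  eliminate u c (w , z) = removeAt (u c ⊛ w ⊖ w c ⊛ u) c , removeAt z c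

  eliminate-· : (u w z : Fin (suc n) → ℤ) (c : Fin (suc n)) →
    removeAt (u c ⊛ w ⊖ w c ⊛ u) c · removeAt z c ≡ u c ℤ.* (w · z) ℤ.- w c ℤ.* (u · z)
  eliminate-· u w z c = begin
    removeAt (u c ⊛ w ⊖ w c ⊛ u) c · removeAt z c ≡⟨ ·-removeAt (u c ⊛ w ⊖ w c ⊛ u) z c (cancel (u c) (w c)) ⟩
    (u c ⊛ w ⊖ w c ⊛ u) · z                       ≡⟨ ⊖-· (u c ⊛ w) (w c ⊛ u) z ⟩
    (u c ⊛ w) · z ℤ.- (w c ⊛ u) · z               ≡⟨ cong₂ ℤ._-_ (⊛-· (u c) w z) (⊛-· (w c) u z) ⟩
    u c ℤ.* (w · z) ℤ.- w c ℤ.* (u · z)           ∎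
    where
    open ≡-Reasoning
    cancel : ∀ x y → x ℤ.* y ℤ.- y ℤ.* x ≡ + 0
    cancel = ℤ-Solver.solve-∀

  -- Such a matrix is invertible modulo `ℓ` and factors through dimension `n`. In the induction,
  -- elimination with the first pair drops one pair and one coordinate; modulo `ℓ` it multiplies the
  -- other entries by `u c`, since `u` is orthogonal to all later second components.
  triangular-bound : (ps : List (VectorPair n)) → AllPairs RightOf ps → All Diagonal ps → length ps ≤ n
  triangular-bound []             _  _ = z≤n
  triangular-bound {zero}  (_ ∷ _) _ (d ∷ _) = contradiction (divides (+ 0) refl) d
  triangular-bound {suc n} ((u , v) ∷ ps) (u⊥ps ∷ tri) (d ∷ ds)
    with ∤·⇒∤coordinate u v d
  ... | c , ℓ∤uc = s≤s (subst (_≤ n) (length-map (eliminate u c) ps)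
    (triangular-bound (map (eliminate u c) ps)
      (AllPairs.map⁺ (AllPairs.zipWith (λ {q} {q′} → right {q} {q′}) (tri , All⇒AllPairs u⊥ps)))
      (All.map⁺ (All.zipWith (λ {q} → diagonal {q}) (ds , u⊥ps)))))
    where
    right : ∀ {q q′ : VectorPair (suc n)} → RightOf q q′ × ℓ∣ u · proj₂ q′ →
      RightOf (eliminate u c q) (eliminate u c q′)
    right {w , _} {_ , z} (ℓ∣wz , ℓ∣uz) = subst ℓ∣_ (sym (eliminate-· u w z c))
      (ℤ∣.∣m∣n⇒∣m-n (ℤ∣.∣n⇒∣m*n (u c) ℓ∣wz) (ℤ∣.∣n⇒∣m*n (w c) ℓ∣uz))

    diagonal : ∀ {q : VectorPair (suc n)} → Diagonal q × ℓ∣ u · proj₂ q → Diagonal (eliminate u c q)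
    -- Adding back the subtracted multiple of `ℓ` leaves `u c ℤ.* (w · z)`, from which `u c` cancels
    -- by primality.
    diagonal {w , z} (ℓ∤wz , ℓ∣uz) ℓ∣elim = ℓ∤wz (ℤ-euclid (u c) (w · z)
      (subst ℓ∣_ (add-back (u c ℤ.* (w · z)) (w c ℤ.* (u · z)))
        (ℤ∣.∣m∣n⇒∣m+n (subst ℓ∣_ (eliminate-· u w z c) ℓ∣elim) (ℤ∣.∣n⇒∣m*n (w c) ℓ∣uz))) ℓ∤uc)
      where
      add-back : ∀ x y → x ℤ.- y ℤ.+ y ≡ x
      add-back = ℤ-Solver.solve-∀

-- Indicator vectors

χ : Subset n → Fin n → ℤ
χ S i = if lookup S i then + 1 else + 0

χ-∈ : ∀ {S : Subset n} {c} → c ∈ S → χ S c ≡ + 1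
χ-∈ c∈S rewrite []=⇒lookup c∈S = refl

χ-∉ : ∀ {S : Subset n} {c} → c ∉ S → χ S c ≡ + 0
χ-∉ {S = S} {c} c∉S with lookup S c in eq
... | outside = refl
... | inside  = contradiction (lookup⇒[]= c S eq) c∉S

χ-·-χ : (S T : Subset n) → χ S · χ T ≡ + ∣ S ∩ T ∣
χ-·-χ []            []            = refl
χ-·-χ (outside ∷ S) (t ∷ T)       = trans (ℤ.+-identityˡ _) (χ-·-χ S T)
χ-·-χ (inside ∷ S)  (outside ∷ T) = trans (ℤ.+-identityˡ _) (χ-·-χ S T)
χ-·-χ (inside ∷ S)  (inside ∷ T)  = cong ℤ.suc (χ-·-χ S T)

χ⊥-· : (v : Fin n → ℤ) → χ ⊥ · v ≡ + 0
χ⊥-· {zero}  v = refl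
χ⊥-· {suc n} v = trans (ℤ.+-identityˡ _) (χ⊥-· (v ∘ suc))

χ⁅⁆-· : (c : Fin n) (v : Fin n → ℤ) → χ ⁅ c ⁆ · v ≡ v c
χ⁅⁆-· zero    v = trans (cong₂ ℤ._+_ (ℤ.*-identityˡ (v zero)) (χ⊥-· (v ∘ suc))) (ℤ.+-identityʳ (v zero))
χ⁅⁆-· (suc c) v = trans (ℤ.+-identityˡ _) (χ⁅⁆-· c (v ∘ suc))

-- Separating coordinates

Separator : ℕ → Set
Separator n = Fin n × Subset n × Subset n

SeparatorIn : List (Subset n) → Separator n → Set
SeparatorIn F (c , S , T) = (S ∈ᴸ F × T ∈ᴸ F) × (c ∈ S × c ∉ T)

Agree : Fin n → Subset n → Subset n → Set
Agree c S T = (c ∈ S × c ∈ T) ⊎ (c ∉ S × c ∉ T)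

-- The source of triangularity: the unit vector at `c` annihilates `χ S ⊖ χ T` for every later pair
-- `S`, `T`.
AgreeLater : Rel (Separator n) _
AgreeLater (c , _) (_ , S , T) = Agree c S T

≢⇒separator : (S T : Subset n) → S ≢ T → ∃[ c ] ((c ∈ S × c ∉ T) ⊎ (c ∈ T × c ∉ S))
≢⇒separator S T S≢T
  with any? (λ c → (c ∈? S) ×-dec ¬? (c ∈? T)) | any? (λ c → (c ∈? T) ×-dec ¬? (c ∈? S))
... | yes (c , sep) | _             = c , inj₁ sep
... | no _          | yes (c , sep) = c , inj₂ sep
... | no S⊆T        | no T⊆S        = contradiction
  (⊆-antisym (λ {c} c∈S → decidable-stable (c ∈? T) (λ c∉T → S⊆T (c , c∈S , c∉T)))
             (λ {c} c∈T → decidable-stable (c ∈? S) (λ c∉S → T⊆S (c , c∈T , c∉S)))) S≢T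

unique⇒separator : (F : List (Subset n)) → Unique F → 1 < length F → ∃[ s ] SeparatorIn F s
unique⇒separator (_ ∷ [])    _               (s≤s ())
unique⇒separator (S ∷ T ∷ F) ((S≢T ∷ _) ∷ _) _ with ≢⇒separator S T S≢T
... | c , inj₁ sep = (c , S , T) , (here refl , there (here refl)) , sep
... | c , inj₂ sep = (c , T , S) , (there (here refl) , here refl) , sep

2^k<m+n : ∀ k x y → 2 ^ suc k < x + y → 2 ^ k < x ⊎ 2 ^ k < y
2^k<m+n k x y 2^1+k< with 2 ^ k <? x | 2 ^ k <? y
... | yes k<x | _       = inj₁ k<x
... | no _    | yes k<y = inj₂ k<y
... | no k≮x  | no k≮y  = contradiction 2^1+k< (≤⇒≯ (begin
  x + y             ≤⟨ +-mono-≤ (≮⇒≥ k≮x) (≮⇒≥ k≮y) ⟩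
  2 ^ k + 2 ^ k     ≡⟨ cong (λ z → 2 ^ k + z) (+-identityʳ (2 ^ k)) ⟨
  2 ^ suc k         ∎))
  where open ≤-Reasoning

-- A separating coordinate splits the family; its larger half contains the next separators.
separators : ∀ k (F : List (Subset n)) → Unique F → 2 ^ k < length F →
  ∃[ ss ] length ss ≡ suc k × AllPairs AgreeLater ss × All (SeparatorIn F) ss
-- More than `2 ^ 0` sets already give one separator, hence the count `suc k`.
separators zero F unique 1<F with unique⇒separator F unique 1<F
... | s , sep = s ∷ [] , refl , [] ∷ [] , sep ∷ []
separators {n} (suc k) F unique 2^1+k<F
  with unique⇒separator F unique (≤-<-trans (^-monoʳ-≤ 2 (z≤n {suc k})) 2^1+k<F)
... | s@(c , _) , sep = extend (2^k<m+n k _ _ (subst (2 ^ suc k <_)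
                          (sym (length-filter-complement (c ∈?_) F)) 2^1+k<F))
  where
  step : {P : Subset n → Set} (P? : Decidable P) → (∀ {S T} → P S → P T → Agree c S T) →
    2 ^ k < length (filter P? F) →
    ∃[ ss ] length ss ≡ suc (suc k) × AllPairs AgreeLater ss × All (SeparatorIn F) ss
  step {P} P? agree 2^k<half with separators k (filter P? F) (Unique.filter⁺ P? unique) 2^k<half
  ... | ss , |ss| , later , seps =
    s ∷ ss , cong suc |ss| ,
    All.map (λ ((S∈ , T∈) , _) → agree (proj₂ (in-half S∈)) (proj₂ (in-half T∈))) seps ∷ later ,
    sep ∷ All.map (λ ((S∈ , T∈) , sep) → (proj₁ (in-half S∈) , proj₁ (in-half T∈)) , sep) seps
    where
    in-half : ∀ {S} → S ∈ᴸ filter P? F → S ∈ᴸ F × P S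
    in-half = ∈-filter⁻ P? {xs = F}

  extend : 2 ^ k < length (filter (c ∈?_) F) ⊎ 2 ^ k < length (filter (¬? ∘ (c ∈?_)) F) →
    ∃[ ss ] length ss ≡ suc (suc k) × AllPairs AgreeLater ss × All (SeparatorIn F) ss
  extend (inj₁ 2^k<) = step (c ∈?_) (λ c∈S c∈T → inj₁ (c∈S , c∈T)) 2^k<
  extend (inj₂ 2^k<) = step (¬? ∘ (c ∈?_)) (λ c∉S c∉T → inj₂ (c∉S , c∉T)) 2^k<

-- Closed neighbourhoods

module Neighbourhoods {m : ℕ} (_~_ : Fin m → Fin m → Set) (_~?_ : ∀ u v → Dec (u ~ v))
  (~-refl : ∀ {v} → v ~ v) (~-sym : ∀ {u v} → u ~ v → v ~ u) where

  near far : Fin m → List (Fin m) → List (Fin m)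
  near v = filter (v ~?_)
  far  v = filter (¬? ∘ (v ~?_))

  length-near-far : ∀ v S → length (near v S) + length (far v S) ≡ length S
  length-near-far v = length-filter-complement (v ~?_)

  -- By reflexivity `v` itself is removed, so the greedy recursions terminate.
  far-< : ∀ {v S} → v ∈ᴸ S → length (far v S) < length S
  far-< {v} v∈S = filter-notAll (¬? ∘ (v ~?_)) _ (Any.map (λ { refl ¬v~v → ¬v~v ~-refl }) v∈S)

  ∈-far⁻ : ∀ v S {u} → u ∈ᴸ far v S → u ∈ᴸ S × ¬ v ~ u
  ∈-far⁻ v S = ∈-filter⁻ (¬? ∘ (v ~?_)) {xs = S}

  far-⊑ : ∀ v S → far v S ⊑ S
  far-⊑ v S = filter-⊆ (¬? ∘ (v ~?_)) S

  near-mono : ∀ v {S T} → S ⊑ T → near v S ⊑ near v T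
  near-mono v = Sublist.filter⁺ (v ~?_) (v ~?_) (λ { refl → id })

  Independent : List (Fin m) → List (Fin m) → Set
  Independent S T = All (_∈ᴸ S) T × AllPairs (λ u v → ¬ u ~ v) T

  independent-∷ : ∀ {v S T} → v ∈ᴸ S → Independent (far v S) T → Independent S (v ∷ T)
  independent-∷ {v} {S} v∈S (T⊆far , indep) =
    v∈S ∷ All.map (proj₁ ∘ ∈-far⁻ v S) T⊆far , All.map (proj₂ ∘ ∈-far⁻ v S) T⊆far ∷ indep

  far-step : ∀ {v S} {k r : ℕ} → length (near v S) ≤ k → length (far v S) ≤ r → length S ≤ k + r
  far-step {v} {S} near≤k far≤r = subst (_≤ _) (length-near-far v S) (+-mono-≤ near≤k far≤r)

  -- Each chosen vertex costs at most `D` elements of `S`.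
  greedy : ∀ D S → (∀ v → length (near v S) ≤ D) → ∃[ T ] Independent S T × length S ≤ D * length T
  greedy D S = go S (<-wellFounded (length S))
    where
    go : ∀ S → Acc _<_ (length S) → (∀ v → length (near v S) ≤ D) →
      ∃[ T ] Independent S T × length S ≤ D * length T
    go []          _         _      = [] , ([] , []) , z≤n
    go S@(v ∷ _) (acc rec) near≤D
      with go (far v S) (rec (far-< (here refl)))
              (λ u → ≤-trans (length-mono-≤ (near-mono u (far-⊑ v S))) (near≤D u))
    ... | T , indep , far≤DT = v ∷ T , independent-∷ (here refl) indep ,
      subst (length S ≤_) (sym (*-suc D (length T))) (far-step {v} {S} (near≤D v) far≤DT)

  vertices : List (Fin m)
  vertices = allFin m

  -- Closure under two steps from `v` says, without mentioning paths, that no edge leaves the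
  -- neighbourhood. Both conditions refer to the whole graph, so they do not change when vertices
  -- are discarded.
  Isolated : ℕ → Fin m → Set
  Isolated d v = d < length (near v vertices) × (∀ u w → v ~ u → u ~ w → v ~ w)

  isolated? : ∀ d → Decidable (Isolated d)
  isolated? d v = (d <? length (near v vertices)) ×-dec
    all? (λ u → all? (λ w → (v ~? u) →-dec ((u ~? w) →-dec (v ~? w))))

  module _ (d : ℕ) (degree : ∀ v → length (near v vertices) ≤ suc d) where

    -- With `d + 1` neighbours in `S`, `u` has none elsewhere: a sublist of full length is the whole
    -- list.
    near-full : ∀ {u w S} → S ⊑ vertices → d < length (near u S) → u ~ w → w ∈ᴸ S
    near-full {u} {w} {S} S⊑ full u~w = proj₁ (∈-filter⁻ (u ~?_) (subst (w ∈ᴸ_)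
      (sym (Pointwise-≡⇒≡ (toPointwise
        (≤-antisym (length-mono-≤ sub) (≤-trans (degree u) full)) sub)))
      (∈-filter⁺ (u ~?_) (∈-allFin w) u~w)))
      where
      sub : near u S ⊑ near u vertices
      sub = near-mono u S⊑

    -- If `v ~ u` and `u ~ w` but not `v ~ w`, then `w` survives in `far v S` and is full there. So
    -- its neighbour `u` survives as well, against `v ~ u`.
    full⇒isolated : ∀ {v S} → S ⊑ vertices → v ∈ᴸ S →
      (∀ {u} → u ∈ᴸ S → d < length (near u S)) →
      (∀ {w} → w ∈ᴸ far v S → d < length (near w (far v S))) → Isolated d v
    full⇒isolated {v} {S} S⊑ v∈S S-full far-full =
      ≤-trans (S-full v∈S) (length-mono-≤ (near-mono v S⊑)) , closed
      where
      closed : ∀ u w → v ~ u → u ~ w → v ~ w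
      closed u w v~u u~w = decidable-stable (v ~? w) λ ¬v~w →
        let u∈S  = near-full S⊑ (S-full v∈S) v~u
            w∈S  = near-full S⊑ (S-full u∈S) u~w
            w∈far = ∈-filter⁺ (¬? ∘ (v ~?_)) w∈S ¬v~w
            u∈far = near-full (⊆-trans (far-⊑ v S) S⊑) (far-full w∈far) (~-sym u~w)
        in proj₂ (∈-far⁻ v S u∈far) v~u

    -- Picking a vertex removes at most d vertices, or removes d + 1 and leaves one whose
    -- removal costs at most d: otherwise the first vertex was isolated.
    paired-greedy : ∀ S → S ⊑ vertices → (∀ {v} → v ∈ᴸ S → ¬ Isolated d v) →
      ∃[ T ] Independent S T × 2 * length S ≤ (2 * d + 1) * length T
    paired-greedy S = go S (<-wellFounded (length S))
      where
      go : ∀ S → Acc _<_ (length S) → S ⊑ vertices → (∀ {v} → v ∈ᴸ S → ¬ Isolated d v) →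
        ∃[ T ] Independent S T × 2 * length S ≤ (2 * d + 1) * length T
      go []          _          _  _ = [] , ([] , []) , z≤n
      go S@(v₀ ∷ _) (acc rec) S⊑ noIsolated with Any.any? (λ v → length (near v S) ≤? d) S
      ... | yes sparse with find sparse
      ...   | v , v∈S , near≤d
        with go (far v S) (rec (far-< v∈S)) (⊆-trans (far-⊑ v S) S⊑)
                (noIsolated ∘ proj₁ ∘ ∈-far⁻ v S)
      ...   | T , indep , bound = v ∷ T , independent-∷ v∈S indep , (begin
        2 * length S                              ≤⟨ *-monoʳ-≤ 2 (far-step {v} {S} near≤d ≤-refl) ⟩
        2 * (d + length (far v S))                ≡⟨ *-distribˡ-+ 2 d _ ⟩
        2 * d + 2 * length (far v S)              ≤⟨ +-mono-≤ (m≤m+n (2 * d) 1) bound ⟩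
        (2 * d + 1) + (2 * d + 1) * length T      ≡⟨ *-suc (2 * d + 1) (length T) ⟨
        (2 * d + 1) * suc (length T)              ∎)
        where open ≤-Reasoning
      go S@(v ∷ _) (acc rec) S⊑ noIsolated | no noneSparse
        with Any.any? (λ w → length (near w (far v S)) ≤? d) (far v S)
      ... | yes sparse with find sparse
      ...   | w , w∈far , near≤d
        with go (far w (far v S)) (rec (<-trans (far-< w∈far) (far-< (here refl))))
                (⊆-trans (far-⊑ w (far v S)) (⊆-trans (far-⊑ v S) S⊑))
                (noIsolated ∘ proj₁ ∘ ∈-far⁻ v S ∘ proj₁ ∘ ∈-far⁻ w (far v S))
      ...   | T , indep , bound =
        v ∷ w ∷ T , independent-∷ (here refl) (independent-∷ w∈far indep) , (begin
        -- Two chosen vertices together cost `suc d + d`, on average half of `2 * d + 1` each.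
        2 * length S                              ≤⟨ *-monoʳ-≤ 2 (far-step {v} {S} near-v≤ (far-step {w} {far v S} near≤d ≤-refl)) ⟩
        2 * (suc d + (d + length rest))           ≡⟨ split d (length rest) ⟩
        2 * (2 * d + 1) + 2 * length rest         ≤⟨ +-monoʳ-≤ (2 * (2 * d + 1)) bound ⟩
        2 * (2 * d + 1) + (2 * d + 1) * length T  ≡⟨ merge (2 * d + 1) (length T) ⟩
        (2 * d + 1) * suc (suc (length T))        ∎)
        where
        open ≤-Reasoning
        rest : List (Fin m)
        rest = far w (far v S)
        near-v≤ : length (near v S) ≤ suc d
        near-v≤ = ≤-trans (length-mono-≤ (near-mono v S⊑)) (degree v)
        split : ∀ d r → 2 * (suc d + (d + r)) ≡ 2 * (2 * d + 1) + 2 * r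
        split = ℕ-Solver.solve-∀
        merge : ∀ k t → 2 * k + k * t ≡ k * suc (suc t)
        merge = ℕ-Solver.solve-∀
      go S@(v ∷ _) (acc rec) S⊑ noIsolated | no noneSparse | no noneFarSparse =
        contradiction
          (full⇒isolated S⊑ (here refl)
            (λ u∈ → ≰⇒> (All.lookup (All.¬Any⇒All¬ _ noneSparse) u∈))
            (λ w∈ → ≰⇒> (All.lookup (All.¬Any⇒All¬ _ noneFarSparse) w∈)))
          (noIsolated (here refl))

-- Oddtowns

module Oddtown (ℓ : ℕ) (prime : Prime ℓ) where

  open Modulo ℓ prime

  Orthogonal : Rel (Subset n) _
  Orthogonal S T = ℓ ∣ ∣ S ∩ T ∣

  orthogonal-sym : (S T : Subset n) → Orthogonal S T → Orthogonal T S
  orthogonal-sym S T = subst (λ R → ℓ ∣ ∣ R ∣) (∩-comm S T)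

  ⊥-orthogonal : (T : Subset n) → Orthogonal ⊥ T
  ⊥-orthogonal {n} T rewrite ∩-zeroˡ T | ∣⊥∣≡0 n = ℓ ∣0

  χ-orthogonal : (S T : Subset n) → Orthogonal S T → ℓ∣ χ S · χ T
  χ-orthogonal S T S⊥T = subst ℓ∣_ (sym (χ-·-χ S T)) (ℤ∣.∣ᵤ⇒∣ S⊥T)

  ·-sym : (u v : Fin n → ℤ) → ℓ∣ u · v → ℓ∣ v · u
  ·-sym u v = subst ℓ∣_ (·-comm u v)

  unit difference : Separator n → Fin n → ℤ
  unit (c , _)           = χ ⁅ c ⁆
  difference (_ , S , T) = χ S ⊖ χ T

  unit-·-later : (s t : Separator n) → AgreeLater s t → ℓ∣ unit s · difference t
  unit-·-later s@(c , _) t@(_ , S , T) agree =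
    subst ℓ∣_ (sym (trans (χ⁅⁆-· c (difference t)) (vanishes agree))) (divides (+ 0) refl)
    where
    vanishes : Agree c S T → difference t c ≡ + 0
    vanishes (inj₁ (c∈S , c∈T)) = cong₂ ℤ._-_ (χ-∈ c∈S) (χ-∈ c∈T)
    vanishes (inj₂ (c∉S , c∉T)) = cong₂ ℤ._-_ (χ-∉ c∉S) (χ-∉ c∉T)

  -- The product is exactly 1, so the rank estimate is the same for every prime.
  unit-·-difference : ∀ {F} (s : Separator n) → SeparatorIn F s → ¬ ℓ∣ unit s · difference s
  unit-·-difference s@(c , S , T) (_ , c∈S , c∉T) ℓ∣1 =
    ¬prime[1] (subst Prime (∣1⇒≡1 (ℤ∣.∣⇒∣ᵤ (subst ℓ∣_ is1 ℓ∣1))) prime)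
    where
    is1 : unit s · difference s ≡ + 1
    is1 = trans (χ⁅⁆-· c (difference s)) (cong₂ ℤ._-_ (χ-∈ c∈S) (χ-∉ c∉T))

  difference-· : ∀ {F} (s : Separator n) (v : Fin n → ℤ) → SeparatorIn F s →
    (∀ {S} → S ∈ᴸ F → ℓ∣ χ S · v) → ℓ∣ difference s · v
  difference-· (_ , S , T) v ((S∈F , T∈F) , _) F⊥v =
    subst ℓ∣_ (sym (⊖-· (χ S) (χ T) v)) (ℤ∣.∣m∣n⇒∣m-n (F⊥v S∈F) (F⊥v T∈F))

  diagonalPair : Subset n → VectorPair n
  diagonalPair S = χ S , χ S

  differenceUnit unitDifference : Separator n → VectorPair n
  differenceUnit s = difference s , unit s
  unitDifference s = unit s , difference s

  IsOddtown : List (Subset n) → Set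
  IsOddtown T = All (λ S → ¬ Orthogonal S S) T × AllPairs Orthogonal T

  diagonalPair-triangular : {T : List (Subset n)} → IsOddtown T →
    AllPairs RightOf (map diagonalPair T) × All Diagonal (map diagonalPair T)
  diagonalPair-triangular (odd , orth) =
    AllPairs.map⁺ (AllPairs.map (λ {S} {R} → χ-orthogonal S R) orth) ,
    All.map⁺ (All.map (λ {S} ℓ∤S ℓ∣χS → ℓ∤S (ℤ∣.∣⇒∣ᵤ (subst ℓ∣_ (χ-·-χ S S) ℓ∣χS))) odd)

  -- The classical oddtown argument: the Gram matrix of the indicator vectors is triangular modulo
  -- `ℓ` with nonzero diagonal.
  oddtown-bound : (T : List (Subset n)) → IsOddtown T → length T ≤ n
  oddtown-bound {n} T oddtown = subst (_≤ n) (length-map diagonalPair T)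
    (triangular-bound (map diagonalPair T) (proj₁ tri) (proj₂ tri))
    where tri = diagonalPair-triangular oddtown

  -- The k + 1 differences from F, the oddtown, and the k + 1 unit vectors separating G form the
  -- rows; the unit vectors separating F, the oddtown and the differences from G the columns.
  flanked-oddtown-bound : ∀ k {F T G : List (Subset n)} →
    Unique F → 2 ^ k < length F → Unique G → 2 ^ k < length G → IsOddtown T →
    (∀ {S R} → S ∈ᴸ F → R ∈ᴸ T → Orthogonal S R) →
    (∀ {S R} → S ∈ᴸ F → R ∈ᴸ G → Orthogonal S R) →
    (∀ {S R} → S ∈ᴸ T → R ∈ᴸ G → Orthogonal S R) →
    suc k + (length T + suc k) ≤ n
  flanked-oddtown-bound {n} k {F} {T} {G} F! k<F G! k<G oddtown F⊥T F⊥G T⊥G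
    with separators k F F! k<F | separators k G G! k<G
  ... | ss , |ss| , ss-later , ss-sep | ts , |ts| , ts-later , ts-sep =
    subst (_≤ n) size (triangular-bound (left ++ (middle ++ right))
      (AllPairs.++⁺ left-tri (AllPairs.++⁺ middle-tri right-tri middle-right)
        (All.zipWith (λ (l-m , l-r) → All.++⁺ l-m l-r) (left-middle , left-right)))
      (All.++⁺ left-diagonal (All.++⁺ middle-diagonal right-diagonal)))
    where
    left middle right : List (VectorPair n)
    -- With differences as rows, the products known to vanish lie below the diagonal in the order of
    -- `ss`; reversal moves them above it.
    left   = map differenceUnit (reverse ss)
    middle = map diagonalPair T
    right  = map unitDifference ts

    size : length (left ++ (middle ++ right)) ≡ suc k + (length T + suc k)
    size = trans (length-++ left) (cong₂ _+_
      (trans (length-map differenceUnit (reverse ss)) (trans (length-reverse ss) |ss|))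
      (trans (length-++ middle) (cong₂ _+_ (length-map diagonalPair T)
        (trans (length-map unitDifference ts) |ts|))))

    ss-sep′ : All (SeparatorIn F) (reverse ss)
    ss-sep′ = All.tabulate λ s∈ → All.lookup ss-sep (Any.reverse⁻ s∈)

    left-tri : AllPairs RightOf left
    left-tri = AllPairs.map⁺ (AllPairs.map
      (λ {s} {t} later → ·-sym (unit t) (difference s) (unit-·-later t s later))
      (AllPairs-reverse⁺ ss-later))

    left-diagonal : All Diagonal left
    left-diagonal = All.map⁺ (All.map
      (λ {s} sep ℓ∣ → unit-·-difference s sep (·-sym (difference s) (unit s) ℓ∣)) ss-sep′)

    middle-tri : AllPairs RightOf middle
    middle-tri = proj₁ (diagonalPair-triangular oddtown)

    middle-diagonal : All Diagonal middle
    middle-diagonal = proj₂ (diagonalPair-triangular oddtown)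

    right-tri : AllPairs RightOf right
    right-tri = AllPairs.map⁺ (AllPairs.map (λ {s} {t} → unit-·-later s t) ts-later)

    right-diagonal : All Diagonal right
    right-diagonal = All.map⁺ (All.map (λ {s} → unit-·-difference s) ts-sep)

    -- Above the diagonal blocks only differences and members of `T` meet, so orthogonality of the
    -- families suffices. Products of a unit vector with another block all fall below.
    left-middle : All (λ p → All (RightOf p) middle) left
    left-middle = All.map⁺ (All.map (λ {s} sep → All.map⁺ (All.tabulate λ {R} R∈T →
      difference-· s (χ R) sep (λ {S} S∈F → χ-orthogonal S R (F⊥T S∈F R∈T)))) ss-sep′)

    left-right : All (λ p → All (RightOf p) right) left
    left-right = All.map⁺ (All.map (λ {s} s-sep → All.map⁺ (All.map (λ {t} t-sep →
      difference-· s (difference t) s-sep λ {S} S∈F → ·-sym (difference t) (χ S)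
        (difference-· t (χ S) t-sep λ {R} R∈G →
          χ-orthogonal R S (orthogonal-sym S R (F⊥G S∈F R∈G)))) ts-sep)) ss-sep′)

    middle-right : All (λ p → All (RightOf p) right) middle
    middle-right = All.map⁺ (All.tabulate λ {S} S∈T → All.map⁺ (All.map (λ {t} t-sep →
      ·-sym (difference t) (χ S) (difference-· t (χ S) t-sep λ {R} R∈G →
        χ-orthogonal R S (orthogonal-sym S R (T⊥G S∈T R∈G)))) ts-sep))

-- Numerical estimates

-- The ceiling is the least exponent whose power of 2 reaches `d + 2`; one less falls short.
2^⌈log₂⌉∸1< : ∀ d → 2 ^ (⌈log₂ (d + 2) ⌉ ∸ 1) < d + 2
2^⌈log₂⌉∸1< d = ≰⇒> λ d+2≤ → <-irrefl refl (begin-strict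
  ⌈log₂ (d + 2) ⌉ ∸ 1                     <⟨ ∸-monoʳ-< {⌈log₂ (d + 2) ⌉} (s≤s z≤n) 1≤ ⟩
  ⌈log₂ (d + 2) ⌉                         ≤⟨ ⌈log₂⌉-mono-≤ d+2≤ ⟩
  ⌈log₂ (2 ^ (⌈log₂ (d + 2) ⌉ ∸ 1)) ⌉     ≡⟨ ⌈log₂2^n⌉≡n (⌈log₂ (d + 2) ⌉ ∸ 1) ⟩
  ⌈log₂ (d + 2) ⌉ ∸ 1                     ∎)
  where
  open ≤-Reasoning
  -- Ensures that the truncated subtraction of 1 really decreases.
  1≤ : 1 ≤ ⌈log₂ (d + 2) ⌉
  1≤ = ⌈log₂⌉-mono-≤ {2} (m≤n+m 2 d)

-- Passes from the ceiling in the bound to the floor in the hypothesis on `n`: both `d` and 2 are at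
-- most `2 ^ suc ⌊log₂ d ⌋`.
⌈log₂⌉≤2+⌊log₂⌋ : ∀ d → ⌈log₂ (d + 2) ⌉ ≤ 2 + ⌊log₂ d ⌋
⌈log₂⌉≤2+⌊log₂⌋ d = begin
  ⌈log₂ (d + 2) ⌉               ≤⟨ ⌈log₂⌉-mono-≤ d+2≤ ⟩
  ⌈log₂ (2 ^ (2 + ⌊log₂ d ⌋)) ⌉ ≡⟨ ⌈log₂2^n⌉≡n (2 + ⌊log₂ d ⌋) ⟩
  2 + ⌊log₂ d ⌋                 ∎
  where
  open ≤-Reasoning
  d≤ : d ≤ 2 ^ suc ⌊log₂ d ⌋
  d≤ = ≮⇒≥ λ 2^<d → <-irrefl refl (begin-strict
    ⌊log₂ d ⌋                     <⟨ n<1+n _ ⟩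
    suc ⌊log₂ d ⌋                 ≡⟨ ⌊log₂[2^n]⌋≡n (suc ⌊log₂ d ⌋) ⟨
    ⌊log₂ (2 ^ suc ⌊log₂ d ⌋) ⌋   ≤⟨ ⌊log₂⌋-mono-≤ (<⇒≤ 2^<d) ⟩
    ⌊log₂ d ⌋                     ∎)
  d+2≤ : d + 2 ≤ 2 ^ (2 + ⌊log₂ d ⌋)
  d+2≤ = begin
    d + 2                                       ≤⟨ +-mono-≤ d≤ (^-monoʳ-≤ 2 {1} {suc ⌊log₂ d ⌋} (s≤s z≤n)) ⟩
    2 ^ suc ⌊log₂ d ⌋ + 2 ^ suc ⌊log₂ d ⌋       ≡⟨ cong (λ z → 2 ^ suc ⌊log₂ d ⌋ + z) (+-identityʳ (2 ^ suc ⌊log₂ d ⌋)) ⟨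
    2 ^ (2 + ⌊log₂ d ⌋)                         ∎

-- The left side is twice the loss from the discarded vertices and from the term `2 * s`. The
-- constant is 2 · 2 · 3: the doubling, `suc d ≤ d + d`, and `1 + 2 * s ≤ 3 * suc L`.
loss-≤ : ∀ {d n} → 1 ≤ d → n ≥ 12 * d * suc ⌊log₂ d ⌋ →
  2 * suc d + 2 * (suc d * (2 * (⌈log₂ (d + 2) ⌉ ∸ 1))) ≤ n
loss-≤ {d} {n} 1≤d large = begin
  2 * suc d + 2 * (suc d * (2 * s))  ≡⟨ collect (suc d) s ⟩
  2 * (suc d * (1 + 2 * s))          ≤⟨ *-monoʳ-≤ 2 (*-mono-≤ (+-monoˡ-≤ d 1≤d) 1+2s≤) ⟩
  2 * ((d + d) * (3 * suc L))        ≡⟨ regroup d (suc L) ⟩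
  12 * d * suc L                     ≤⟨ large ⟩
  n                                  ∎
  where
  open ≤-Reasoning
  s L : ℕ
  s = ⌈log₂ (d + 2) ⌉ ∸ 1
  L = ⌊log₂ d ⌋
  1+2s≤ : 1 + 2 * s ≤ 3 * suc L
  1+2s≤ = +-mono-≤ (s≤s (z≤n {L})) (*-monoʳ-≤ 2 (∸-monoˡ-≤ 1 (⌈log₂⌉≤2+⌊log₂⌋ d)))
  collect : ∀ k s → 2 * k + 2 * (k * (2 * s)) ≡ 2 * (k * (1 + 2 * s))
  collect = ℕ-Solver.solve-∀
  regroup : ∀ d k → 2 * ((d + d) * (3 * k)) ≡ 12 * d * k
  regroup = ℕ-Solver.solve-∀

-- After doubling, the greedy coefficient `2 * d + 1` is one below `2 * suc d`; the spare `n` pays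
-- for the loss.
sparse-arithmetic : ∀ d n h t {m} s → m ≤ suc d + h → 2 * h ≤ (2 * d + 1) * t → t ≤ n →
  2 * suc d + 2 * (suc d * (2 * s)) ≤ n → m ≤ suc d * (n ∸ 2 * s)
sparse-arithmetic d n h t {m} s m≤ 2h≤ t≤n loss =
  *-cancelˡ-≤ 2 (+-cancelʳ-≤ (2 * (suc d * (2 * s))) (2 * m) (2 * (suc d * q)) (begin
    2 * m + 2 * (suc d * (2 * s))                         ≤⟨ +-monoˡ-≤ _ (*-monoʳ-≤ 2 m≤) ⟩
    2 * (suc d + h) + 2 * (suc d * (2 * s))               ≡⟨ regroup (suc d) h (2 * (suc d * (2 * s))) ⟩
    2 * suc d + 2 * (suc d * (2 * s)) + 2 * h             ≤⟨ +-mono-≤ loss (≤-trans 2h≤ (*-monoʳ-≤ (2 * d + 1) t≤n)) ⟩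
    n + (2 * d + 1) * n                                   ≡⟨ collect d n ⟩
    2 * (suc d * n)                                       ≡⟨ cong (λ z → 2 * (suc d * z)) (m∸n+n≡m 2s≤n) ⟨
    2 * (suc d * (q + 2 * s))                             ≡⟨ distribute (suc d) q (2 * s) ⟩
    2 * (suc d * q) + 2 * (suc d * (2 * s))               ∎))
  where
  open ≤-Reasoning
  q : ℕ
  q = n ∸ 2 * s
  -- Makes `n ∸ 2 * s` a true difference.
  2s≤n : 2 * s ≤ n
  2s≤n = ≤-trans (≤-trans (m≤n*m (2 * s) (suc d)) (m≤n*m _ 2)) (≤-trans (m≤n+m _ (2 * suc d)) loss)
  regroup : ∀ k h x → 2 * (k + h) + x ≡ 2 * k + x + 2 * h
  regroup = ℕ-Solver.solve-∀
  collect : ∀ d n → n + (2 * d + 1) * n ≡ 2 * (suc d * n)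
  collect = ℕ-Solver.solve-∀
  distribute : ∀ k q x → 2 * (k * (q + x)) ≡ 2 * (k * q) + 2 * (k * x)
  distribute = ℕ-Solver.solve-∀

-- Each flank has rank `suc s` rather than `s`; the two extra dimensions pay for the two discarded
-- neighbourhoods.
flanked-arithmetic : ∀ d n h t {m} s → m ≤ suc d + (suc d + h) → h ≤ suc d * t →
  suc s + (t + suc s) ≤ n → m ≤ suc d * (n ∸ 2 * s)
flanked-arithmetic d n h t {m} s m≤ h≤ rank = begin
  m                             ≤⟨ m≤ ⟩
  suc d + (suc d + h)           ≤⟨ +-monoʳ-≤ (suc d) (+-monoʳ-≤ (suc d) h≤) ⟩
  suc d + (suc d + suc d * t)   ≡⟨ collect (suc d) t ⟩
  suc d * (2 + t)               ≤⟨ *-monoʳ-≤ (suc d) (m+n≤o⇒m≤o∸n (2 + t) (subst (_≤ n) (regroup s t) rank)) ⟩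
  suc d * (n ∸ 2 * s)           ∎
  where
  open ≤-Reasoning
  collect : ∀ k t → k + (k + k * t) ≡ k * (2 + t)
  collect = ℕ-Solver.solve-∀
  regroup : ∀ s t → suc s + (t + suc s) ≡ 2 + t + 2 * s
  regroup = ℕ-Solver.solve-∀

-- The graph of a defect oddtown

length≤1+length-filter-≢ : ∀ {m} (i : Fin m) {js : List (Fin m)} → Unique js →
  length js ≤ suc (length (filter (λ j → ¬? (i ≟ j)) js))
length≤1+length-filter-≢ i []            = z≤n
length≤1+length-filter-≢ i (_∷_ {j} j∉ unique) with i ≟ j
... | yes refl rewrite filter-all (λ j → ¬? (i ≟ j)) j∉ = ≤-refl
... | no _     = s≤s (length≤1+length-filter-≢ i unique)

module DefectOddtown (ℓ : ℕ) (prime : Prime ℓ) (d n m : ℕ) (A : Fin m → Subset n)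
  (A-injective : Injective _≡_ _≡_ A) (defect : IsDefectOddtown d ℓ {{prime⇒nonZero prime}} A) where

  open Oddtown ℓ prime

  private
    instance
      ℓ≢0 : NonZero ℓ
      ℓ≢0 = prime⇒nonZero prime

  _~_ : Fin m → Fin m → Set
  i ~ j = NotDiv ℓ ∣ A i ∩ A j ∣

  _~?_ : ∀ i j → Dec (i ~ j)
  i ~? j = ¬? (∣ A i ∩ A j ∣ % ℓ ≟ℕ 0)

  ~-refl : ∀ {i} → i ~ i
  ~-refl {i} rewrite ∩-idem (A i) = proj₁ (defect i)

  ~-sym : ∀ {i j} → i ~ j → j ~ i
  ~-sym {i} {j} = subst (λ S → NotDiv ℓ ∣ S ∣) (∩-comm (A i) (A j))

  open Neighbourhoods _~_ _~?_ ~-refl ~-sym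

  ≁⇒orthogonal : ∀ i j → ¬ i ~ j → Orthogonal (A i) (A j)
  ≁⇒orthogonal i j i≁j = m%n≡0⇒n∣m _ ℓ (decidable-stable (∣ A i ∩ A j ∣ % ℓ ≟ℕ 0) i≁j)

  -- `badPartners` leaves out `i`, the closed neighbourhood contains it; hence `suc d`.
  degree : ∀ i → length (near i vertices) ≤ suc d
  degree i = ≤-trans
    (length≤1+length-filter-≢ i (Unique.filter⁺ (i ~?_) (Unique.allFin⁺ m)))
    (s≤s (proj₂ (defect i)))

  independent⇒oddtown : ∀ {S T} → Independent S T → IsOddtown (map A T)
  independent⇒oddtown (_ , indep) =
    All.map⁺ (All.tabulate λ {i} _ ℓ∣ → ~-refl {i} (n∣m⇒m%n≡0 _ ℓ ℓ∣)) ,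
    AllPairs.map⁺ (AllPairs.map (λ {i} {j} → ≁⇒orthogonal i j) indep)

  -- The empty set raises the count from `d + 1` to `d + 2`, the number under the logarithm, and is
  -- orthogonal to everything.
  flank : Fin m → List (Subset n)
  flank v = ⊥ ∷ map A (near v vertices)

  flank-unique : ∀ v → Unique (flank v)
  flank-unique v =
    -- The empty set is new: its size is divisible by `ℓ`, that of each `A i` is not.
    All.map⁺ (All.tabulate λ {i} _ ⊥≡Ai → proj₁ (defect i)
      (n∣m⇒m%n≡0 _ ℓ (subst (λ S → ℓ ∣ ∣ S ∣) ⊥≡Ai (subst (ℓ ∣_) (sym (∣⊥∣≡0 n)) (ℓ ∣0))))) ∷
    Unique.map⁺ A-injective (Unique.filter⁺ (v ~?_) (Unique.allFin⁺ m))

  flank-large : ∀ {v} → Isolated d v → 2 ^ (⌈log₂ (d + 2) ⌉ ∸ 1) < length (flank v)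
  flank-large {v} (full , _) = <-≤-trans (2^⌈log₂⌉∸1< d)
    (subst₂ _≤_ (+-comm 2 d) (cong suc (sym (length-map A (near v vertices)))) (s≤s full))

  flank-orthogonal : ∀ {v S} R → (∀ i → v ~ i → Orthogonal (A i) R) → S ∈ᴸ flank v → Orthogonal S R
  flank-orthogonal     R near⊥R (here refl) = ⊥-orthogonal R
  flank-orthogonal {v} R near⊥R (there S∈) with ∈-map⁻ A S∈
  ... | i , i∈near , refl = near⊥R i (proj₂ (∈-filter⁻ (v ~?_) {xs = vertices} i∈near))

  -- An edge from `i` to `j` would put `j` into the neighbourhood of `v`.
  near⊥far : ∀ {v} → Isolated d v → ∀ {i j} → v ~ i → ¬ v ~ j → Orthogonal (A i) (A j)
  near⊥far (_ , closed) {i} {j} v~i v≁j = ≁⇒orthogonal i j λ i~j → v≁j (closed i j v~i i~j)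

  Bound : Set
  Bound = m ≤ suc d * (n ∸ 2 * (⌈log₂ (d + 2) ⌉ ∸ 1))

  -- Allowing `suc d` vertices outside `S` covers both uses: all vertices, and those far from one
  -- isolated vertex.
  few-isolated-bound : 1 ≤ d → n ≥ 12 * d * suc ⌊log₂ d ⌋ →
    ∀ S → S ⊑ vertices → m ≤ suc d + length S → (∀ {v} → v ∈ᴸ S → ¬ Isolated d v) → Bound
  few-isolated-bound 1≤d large S S⊑ m≤ none with paired-greedy d degree S S⊑ none
  ... | T , indep , 2S≤ = sparse-arithmetic d n (length S) (length T) (⌈log₂ (d + 2) ⌉ ∸ 1) m≤ 2S≤
    (subst (_≤ n) (length-map A T) (oddtown-bound (map A T) (independent⇒oddtown indep)))
    (loss-≤ 1≤d large)

  m≡near+far : ∀ v → m ≡ length (near v vertices) + length (far v vertices)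
  m≡near+far v = trans (sym (length-tabulate id)) (sym (length-near-far v vertices))

  m≤1+d+far : ∀ v → m ≤ suc d + length (far v vertices)
  m≤1+d+far v = subst (_≤ suc d + length (far v vertices)) (sym (m≡near+far v)) (+-monoˡ-≤ _ (degree v))

  two-isolated-bound : ∀ v w → Isolated d v → Isolated d w → ¬ v ~ w → Bound
  two-isolated-bound v w v-iso w-iso v≁w = helper (greedy (suc d) rest rest-degree)
    where
    rest : List (Fin m)
    rest = far w (far v vertices)

    rest⊑ : rest ⊑ vertices
    rest⊑ = ⊆-trans (far-⊑ w (far v vertices)) (far-⊑ v vertices)

    rest-degree : ∀ i → length (near i rest) ≤ suc d
    rest-degree i = ≤-trans (length-mono-≤ (near-mono i rest⊑)) (degree i)

    m≤ : m ≤ suc d + (suc d + length rest)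
    m≤ = ≤-trans (m≤1+d+far v) (+-monoʳ-≤ (suc d) (far-step {w} {far v vertices}
      (≤-trans (length-mono-≤ (near-mono w (far-⊑ v vertices))) (degree w)) ≤-refl))

    -- A common neighbour `j` would give `v ~ w`, since `v` is isolated. This separates the two
    -- flanks.
    w-near⇒v-far : ∀ {j} → w ~ j → ¬ v ~ j
    w-near⇒v-far {j} w~j v~j = v≁w (proj₂ v-iso j w v~j (~-sym w~j))

    helper : (∃[ T ] Independent rest T × length rest ≤ suc d * length T) → Bound
    helper (T , indep , rest≤) = flanked-arithmetic d n (length rest) (length T) s m≤ rest≤
      (subst (λ t → suc s + (t + suc s) ≤ n) (length-map A T)
        (flanked-oddtown-bound s (flank-unique v) (flank-large v-iso) (flank-unique w)
          (flank-large w-iso) (independent⇒oddtown indep)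
          v⊥T
          (λ {S} {R} S∈v R∈w → flank-orthogonal R (λ i v~i → orthogonal-sym R (A i)
            (flank-orthogonal (A i) (λ j w~j →
              orthogonal-sym (A i) (A j) (near⊥far v-iso v~i (w-near⇒v-far w~j))) R∈w)) S∈v)
          (λ {S} {R} S∈T R∈w → orthogonal-sym R S (w⊥T R∈w S∈T))))
      where
      s : ℕ
      s = ⌈log₂ (d + 2) ⌉ ∸ 1

      w⊥T : ∀ {S R} → S ∈ᴸ flank w → R ∈ᴸ map A T → Orthogonal S R
      w⊥T S∈w R∈T with ∈-map⁻ A R∈T
      ... | j , j∈T , refl = flank-orthogonal (A j) (λ i w~i → near⊥far w-iso w~i
        (proj₂ (∈-far⁻ w (far v vertices) (All.lookup (proj₁ indep) j∈T)))) S∈w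

      v⊥T : ∀ {S R} → S ∈ᴸ flank v → R ∈ᴸ map A T → Orthogonal S R
      v⊥T S∈v R∈T with ∈-map⁻ A R∈T
      ... | j , j∈T , refl = flank-orthogonal (A j) (λ i v~i → near⊥far v-iso v~i
        (proj₂ (∈-far⁻ v vertices (proj₁ (∈-far⁻ w (far v vertices) (All.lookup (proj₁ indep) j∈T)))))) S∈v

  bound : 1 ≤ d → n ≥ 12 * d * suc ⌊log₂ d ⌋ → Bound
  bound 1≤d large with any? (isolated? d)
  ... | no none = few-isolated-bound 1≤d large vertices ⊆-refl
    (≤-trans (≤-reflexive (sym (length-tabulate id))) (m≤n+m _ (suc d)))
    (λ {v} _ v-iso → none (v , v-iso))
  ... | yes (v , v-iso) with any? (λ w → isolated? d w ×-dec ¬? (v ~? w))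
  ...   | yes (w , w-iso , v≁w) = two-isolated-bound v w v-iso w-iso v≁w
  -- Every isolated vertex is adjacent to `v`, so none remains in `far v vertices`.
  ...   | no none = few-isolated-bound 1≤d large (far v vertices) (far-⊑ v vertices) (m≤1+d+far v)
    (λ {w} w∈far w-iso → none (w , w-iso , proj₂ (∈-far⁻ v vertices w∈far)))

theorem1p6 : Σ ℕ λ C → 1 ≤ C ×
    ((ℓ : ℕ) → (pℓ : Prime ℓ) → (d : ℕ) → 1 ≤ d → (n : ℕ) →
    n ≥ C * d * suc ⌊log₂ d ⌋ →
    (m : ℕ) → (A : Fin m → Subset n) → Injective _≡_ _≡_ A →
    IsDefectOddtown d ℓ {{prime⇒nonZero pℓ}} A →
    m ≤ (d + 1) * (n ∸ 2 * (⌈log₂ (d + 2) ⌉ ∸ 1)))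
-- The constant is the one computed in `loss-≤`.
theorem1p6 = 12 , s≤s z≤n , λ ℓ pℓ d 1≤d n large m A A-injective defect →
  subst (λ k → m ≤ k * (n ∸ 2 * (⌈log₂ (d + 2) ⌉ ∸ 1))) (+-comm 1 d)
    (DefectOddtown.bound ℓ pℓ d n m A A-injective defect 1≤d large)
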